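{- Let $n\geq 1$. If $\mathcal{N}:L_n([0,1])\to L_n([0,1])$ is an $n$-dimensional strong fuzzy negation, then $\mathcal{N}$ preserves degenerate elements, i.e. $\mathcal{N}(/x/)\in\mathcal{D}_n$ for all $x\in[0,1]$.
   Context: $L_n([0,1])=\{(x_1,\ldots,x_n)\in[0,1]^n : x_1\leq\cdots\leq x_n\}$ with the componentwise order. For $x\in[0,1]$, $/x/=(x,\ldots,x)$; $\mathcal{D}_n=\{/x/ : x\in[0,1]\}$ is the set of degenerate elements. An $n$-dimensional fuzzy negation is a function $\mathcal{N}:L_n([0,1])\to L_n([0,1])$ with $\mathcal{N}(/0/)=/1/$, $\mathcal{N}(/1/)=/0/$ and $\mathcal{N}(\mathbf{x})\geq\mathcal{N}(\mathbf{y})$ whenever $\mathbf{x}\leq\mathbf{y}$. It is strong if $\mathcal{N}(\mathcal{N}(\mathbf{x}))=\mathbf{x}$ for all $\mathbf{x}\in L_n([0,1])$. -}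

module Defs where

open import Data.Empty using (⊥)
open import Data.Fin.Base as Fin using (Fin)
open import Data.Nat.Base using (ℕ)
open import Data.Product.Base using (∃; _×_; _,_; proj₁; proj₂; swap)
open import Data.Rational.Base as ℚ using (ℚ; 0ℚ; 1ℚ)
import Data.Rational.Properties as ℚ
open import Data.Sum.Base using (_⊎_; inj₁; inj₂)
open import Data.Vec.Functional using (Vector)
open import Data.Vec.Functional.Relation.Binary.Pointwise using (Pointwise)
open import Function.Base using (id; _∘_; flip)
open import Level using (0ℓ)
open import Relation.Binary.Core using (Rel; _Preserves_⟶_)
open import Relation.Binary.Definitions using (tri<; tri≈; tri>)
open import Relation.Binary.PropositionalEquality.Core using (refl; subst)
open import Relation.Binary.Structures using (IsPartialOrder)
open import Relation.Unary using (Pred)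

-- Dedekind cuts of ℚ: L is the set of rationals below the real number, U the
-- set of rationals above it.  Distinct records can represent the same real, so
-- real numbers are compared by _≈ℝ_ rather than by propositional equality.

record ℝ : Set₁ where
  field
    L U         : Pred ℚ 0ℓ
    L-inhabited : ∃ L
    U-inhabited : ∃ U
    L-closed    : ∀ {p q} → p ℚ.< q → L q → L p
    U-closed    : ∀ {p q} → p ℚ.< q → U p → U q
    L-open      : ∀ {p} → L p → ∃ λ q → p ℚ.< q × L q
    U-open      : ∀ {q} → U q → ∃ λ p → p ℚ.< q × U p
    disjoint    : ∀ {q} → L q → U q → ⊥
    located     : ∀ {p q} → p ℚ.< q → L p ⊎ U q

infix 4 _≤ℝ_ _≈ℝ_

_≤ℝ_ : Rel ℝ 0ℓ
x ≤ℝ y = ∀ {q} → ℝ.L x q → ℝ.L y q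

_≈ℝ_ : Rel ℝ 0ℓ
x ≈ℝ y = x ≤ℝ y × y ≤ℝ x

≤ℝ-isPartialOrder : IsPartialOrder _≈ℝ_ _≤ℝ_
≤ℝ-isPartialOrder = record
  { isPreorder = record
    { isEquivalence = record
      { refl  = id , id
      ; sym   = swap
      ; trans = λ (x≤y , y≤x) (y≤z , z≤y) → (y≤z ∘ x≤y) , (y≤x ∘ z≤y)
      }
    ; reflexive = λ x≈y → proj₁ x≈y
    ; trans     = λ x≤y y≤z → y≤z ∘ x≤y
    }
  ; antisym = λ x≤y y≤x → x≤y , y≤x
  }

fromℚ : ℚ → ℝ
fromℚ r = record
  { L           = ℚ._< r
  ; U           = r ℚ.<_
  ; L-inhabited = r ℚ.- 1ℚ ,
      subst (r ℚ.- 1ℚ ℚ.<_) (ℚ.+-identityʳ r)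
            (ℚ.+-monoʳ-< r (ℚ.negative⁻¹ (ℚ.- 1ℚ)))
  ; U-inhabited = r ℚ.+ 1ℚ ,
      subst (ℚ._< r ℚ.+ 1ℚ) (ℚ.+-identityʳ r)
            (ℚ.+-monoʳ-< r (ℚ.positive⁻¹ 1ℚ))
  ; L-closed    = ℚ.<-trans
  ; U-closed    = flip ℚ.<-trans
  ; L-open      = λ p<r → let m , p<m , m<r = ℚ.<-dense p<r in m , p<m , m<r
  ; U-open      = λ r<q → let m , r<m , m<q = ℚ.<-dense r<q in m , m<q , r<m
  ; disjoint    = ℚ.<-asym
  ; located     = cut
  }
  where
  cut : ∀ {p q} → p ℚ.< q → p ℚ.< r ⊎ r ℚ.< q
  cut {p} p<q with ℚ.<-cmp p r
  ... | tri< p<r _ _    = inj₁ p<r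
  ... | tri≈ _ refl _   = inj₂ p<q
  ... | tri> _ _ r<p    = inj₂ (ℚ.<-trans r<p p<q)

0ℝ 1ℝ : ℝ
0ℝ = fromℚ 0ℚ
1ℝ = fromℚ 1ℚ

0ℝ≤1ℝ : 0ℝ ≤ℝ 1ℝ
0ℝ≤1ℝ q<0 = ℚ.<-trans q<0 (ℚ.positive⁻¹ 1ℚ)

record [0,1] : Set₁ where
  field
    value   : ℝ
    0≤value : 0ℝ ≤ℝ value
    value≤1 : value ≤ℝ 1ℝ

infix 4 _≤ᴵ_ _≈ᴵ_

_≤ᴵ_ _≈ᴵ_ : Rel [0,1] 0ℓ
x ≤ᴵ y = [0,1].value x ≤ℝ [0,1].value y
x ≈ᴵ y = [0,1].value x ≈ℝ [0,1].value y

0ᴵ 1ᴵ : [0,1]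
0ᴵ = record { value = 0ℝ ; 0≤value = id    ; value≤1 = 0ℝ≤1ℝ }
1ᴵ = record { value = 1ℝ ; 0≤value = 0ℝ≤1ℝ ; value≤1 = id }

record Lₙ (n : ℕ) : Set₁ where
  field
    components : Vector [0,1] n
    increasing : components Preserves Fin._≤_ ⟶ _≤ᴵ_

infix 4 _≤ᴸ_ _≈ᴸ_

_≤ᴸ_ _≈ᴸ_ : ∀ {n} → Rel (Lₙ n) 0ℓ
𝐱 ≤ᴸ 𝐲 = Pointwise _≤ᴵ_ (Lₙ.components 𝐱) (Lₙ.components 𝐲)
𝐱 ≈ᴸ 𝐲 = Pointwise _≈ᴵ_ (Lₙ.components 𝐱) (Lₙ.components 𝐲)

/_/ : ∀ {n} → [0,1] → Lₙ n
/ x / = record { components = λ _ → x ; increasing = λ _ → id }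

𝒟 : ∀ n → Pred (Lₙ n) _
𝒟 n 𝐱 = ∃ λ x → 𝐱 ≈ᴸ / x /

record IsFuzzyNegation {n} (𝒩 : Lₙ n → Lₙ n) : Set₁ where
  field
    𝒩/0/≈/1/ : 𝒩 / 0ᴵ / ≈ᴸ / 1ᴵ /
    𝒩/1/≈/0/ : 𝒩 / 1ᴵ / ≈ᴸ / 0ᴵ /
    antitone : 𝒩 Preserves _≤ᴸ_ ⟶ flip _≤ᴸ_

  -- Hence 𝒩 is a function on L_n([0,1]) with _≈ᴸ_ as its equality; no separate
  -- congruence hypothesis is needed.
  cong : 𝒩 Preserves _≈ᴸ_ ⟶ _≈ᴸ_
  cong {𝐱} {𝐲} 𝐱≈𝐲 i =
    antitone {𝐲} {𝐱} (λ j → proj₂ (𝐱≈𝐲 j)) i ,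
    antitone {𝐱} {𝐲} (λ j → proj₁ (𝐱≈𝐲 j)) i

record IsStrongFuzzyNegation {n} (𝒩 : Lₙ n → Lₙ n) : Set₁ where
  field
    isFuzzyNegation : IsFuzzyNegation 𝒩
    involutive      : ∀ 𝐱 → 𝒩 (𝒩 𝐱) ≈ᴸ 𝐱

  open IsFuzzyNegation isFuzzyNegation public

{-# OPTIONS --safe #-}

-- The element / x / is both join- and meet-irreducible, hence so is
-- 𝐜 = 𝒩 / x /.  Writing 𝐜 as a join of / c₁ / and (0,c₂,…,cₙ) gives c₁ = 0 or
-- cₙ = c₁, so it remains to see that c₁ ≠ 0 when x ≠ 1.  Meet-irreducibility
-- says that every cⱼ is c₁ or 1.  Hence if c₁ = 0 then 𝐜 consists of zeros
-- followed by ones, and along a strictly increasing sequence of x the number of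
-- zeros would have to grow beyond n.
-- Constructively, the order on ℝ is ¬¬-stable, so this case analysis is
-- carried out under double negation.

module Submission where

open import Defs
open import Data.Fin.Base as Fin using (Fin; zero; suc; toℕ; fromℕ; inject₁)
import Data.Fin.Induction as Fin
import Data.Fin.Properties as Fin
open import Data.Nat.Base using (ℕ; suc; _≤_; _<_; z≤n; s≤s)
import Data.Nat.Properties as ℕ
open import Data.Product.Base using (∃; _×_; _,_; proj₁; proj₂)
import Data.Rational.Base as ℚ
import Data.Rational.Properties as ℚ
open import Data.Sum.Base using (_⊎_; inj₁; inj₂; [_,_]; [_,_]′; map)
open import Function.Base using (id; _∘_)
open import Relation.Binary.Definitions using (tri<; tri≈; tri>)
open import Relation.Binary.PropositionalEquality using (_≡_; refl; sym; subst)
open import Relation.Nullary using (¬_; contradiction)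
open import Relation.Unary using (_∈_)

open ℝ
open [0,1]
open Lₙ

-- Order on Dedekind reals under double negation

L<U : ∀ x {p q} → L x p → U x q → p ℚ.< q
L<U x {p} {q} p<x x<q with ℚ.<-cmp p q
... | tri< p<q _ _  = p<q
... | tri≈ _ refl _ = contradiction x<q (disjoint x p<x)
... | tri> _ _ q<p  = contradiction (U-closed x q<p x<q) (disjoint x p<x)

-- Openness of the lower cut moves `q` up to some `r` still below `x`, which leaves the gap that
-- `located` needs. The premise is a negation, and this is the source of stability.
≯⇒≤ : ∀ x y → (∀ {q} → L x q → ¬ U y q) → x ≤ℝ y
≯⇒≤ x y x≯y q<x with L-open x q<x
... | r , q<r , r<x = [ id , (λ y<r → contradiction y<r (x≯y r<x)) ] (located y q<r)

≤ℝ-stable : ∀ x y → ¬ ¬ (x ≤ℝ y) → x ≤ℝ y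
≤ℝ-stable x y ¬x≰y = ≯⇒≤ x y λ q<x y<q → ¬x≰y λ x≤y → disjoint y (x≤y q<x) y<q

≰⇒≥ : ∀ x y → ¬ (x ≤ℝ y) → y ≤ℝ x
≰⇒≥ x y x≰y = ≯⇒≤ y x λ q<y x<q → x≰y λ p<x → L-closed y (L<U x p<x x<q) q<y

≤ᴵ-total : ∀ x y → ¬ ¬ (x ≤ᴵ y ⊎ y ≤ᴵ x)
≤ᴵ-total x y k = k (inj₂ (≰⇒≥ (value x) (value y) λ x≤y → k (inj₁ x≤y)))

between-1 : ∀ x → ¬ (1ᴵ ≤ᴵ x) → ¬ ¬ (∃ λ y → x ≤ᴵ y × ¬ (y ≤ᴵ x) × ¬ (1ᴵ ≤ᴵ y))
between-1 x 1≰x k = 1≰x (≯⇒≤ 1ℝ (value x) λ q<1 x<q → k (above q<1 x<q))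
  where
  above : ∀ {q} → q ℚ.< ℚ.1ℚ → U (value x) q → ∃ λ y → x ≤ᴵ y × ¬ (y ≤ᴵ x) × ¬ (1ᴵ ≤ᴵ y)
  above q<1 x<q with ℚ.<-dense q<1
  -- The new point is the rational `r`; the bound `q` separates it from `x`.
  ... | r , q<r , r<1 = y , x≤y , (λ y≤x → disjoint (value x) (y≤x q<r) x<q)
                          , (λ 1≤y → ℚ.<-irrefl refl (1≤y r<1))
    where
    x≤y : value x ≤ℝ fromℚ r
    x≤y p<x = ℚ.<-trans (L<U (value x) p<x x<q) q<r

    y : [0,1]
    y = record
      { value   = fromℚ r
      ; 0≤value = λ p<0 → x≤y (0≤value x p<0)
      ; value≤1 = λ p<r → ℚ.<-trans p<r r<1
      }

-- Splicing two increasing tuples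

module _ {n} (k : ℕ) (𝐚 𝐛 : Lₙ n)
         (𝐚≤𝐛 : ∀ i j → toℕ i < k → k ≤ toℕ j → components 𝐚 i ≤ᴵ components 𝐛 j) where

  -- (a₁,…,aₖ,bₖ₊₁,…,bₙ)
  splice : Lₙ n
  splice .components i = [ (λ _ → components 𝐚 i) , (λ _ → components 𝐛 i) ]′ (ℕ.<-≤-connex (toℕ i) k)
  splice .increasing {i} {j} i≤j with ℕ.<-≤-connex (toℕ i) k | ℕ.<-≤-connex (toℕ j) k
  ... | inj₁ _   | inj₁ _   = increasing 𝐚 {i} {j} i≤j
  ... | inj₁ i<k | inj₂ k≤j = 𝐚≤𝐛 i j i<k k≤j
  ... | inj₂ k≤i | inj₁ j<k = contradiction (ℕ.≤-<-trans i≤j j<k) (ℕ.≤⇒≯ k≤i)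
  ... | inj₂ _   | inj₂ _   = increasing 𝐛 {i} {j} i≤j

  splice-elim : (P : Fin n → [0,1] → Set) →
                (∀ i → toℕ i < k → P i (components 𝐚 i)) →
                (∀ i → k ≤ toℕ i → P i (components 𝐛 i)) →
                ∀ i → P i (components splice i)
  splice-elim P Pa Pb i with ℕ.<-≤-connex (toℕ i) k
  ... | inj₁ i<k = Pa i i<k
  ... | inj₂ k≤i = Pb i k≤i

  splice-≥ : ∀ i → k ≤ toℕ i → components splice i ≡ components 𝐛 i
  splice-≥ i k≤i with ℕ.<-≤-connex (toℕ i) k
  ... | inj₁ i<k = contradiction i<k (ℕ.≤⇒≯ k≤i)
  ... | inj₂ _   = refl

-- Irreducibility of degenerate elements

module _ {m : ℕ} where

  private
    n : ℕ
    n = suc m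

    last : Fin n
    last = fromℕ m

  first≤ : (𝐱 : Lₙ n) → ∀ i → components 𝐱 zero ≤ᴵ components 𝐱 i
  first≤ 𝐱 i = increasing 𝐱 {zero} {i} z≤n

  ≤last : (𝐱 : Lₙ n) → ∀ i → components 𝐱 i ≤ᴵ components 𝐱 last
  ≤last 𝐱 i = increasing 𝐱 {i} {last} (Fin.≤fromℕ i)

  -- Let `t` be the larger of the two first components. Then `(t,x,…,x)` bounds both elements, so
  -- `x ≤ᴵ t`, and the element starting with `t` dominates `/ x /`. Joins are described by the order
  -- alone, so that an antitone involution can transport them.
  degenerate-join-irreducible : ∀ x (𝐮 𝐯 : Lₙ n) → 𝐮 ≤ᴸ / x / → 𝐯 ≤ᴸ / x / →
    (∀ 𝐰 → 𝐮 ≤ᴸ 𝐰 → 𝐯 ≤ᴸ 𝐰 → / x / ≤ᴸ 𝐰) → ¬ ¬ (/ x / ≤ᴸ 𝐮 ⊎ / x / ≤ᴸ 𝐯)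
  degenerate-join-irreducible x 𝐮 𝐯 𝐮≤x 𝐯≤x least k =
    ≤ᴵ-total (components 𝐮 zero) (components 𝐯 zero)
      λ { (inj₁ u≤v) → k (inj₂ (λ i → first≤ 𝐯 i ∘ x≤ (components 𝐯 zero) (𝐯≤x zero) u≤v id))
        ; (inj₂ v≤u) → k (inj₁ (λ i → first≤ 𝐮 i ∘ x≤ (components 𝐮 zero) (𝐮≤x zero) id v≤u))
        }
    where
    x≤ : ∀ t → t ≤ᴵ x → components 𝐮 zero ≤ᴵ t → components 𝐯 zero ≤ᴵ t → x ≤ᴵ t
    x≤ t t≤x u≤t v≤t = least 𝐰 (≤𝐰 𝐮 𝐮≤x u≤t) (≤𝐰 𝐯 𝐯≤x v≤t) zero
      where
      t≤x′ : (i j : Fin n) → toℕ i < 1 → 1 ≤ toℕ j → t ≤ᴵ x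
      t≤x′ _ _ _ _ = t≤x

      𝐰 : Lₙ n
      𝐰 = splice 1 / t / / x / t≤x′

      ≤𝐰 : ∀ 𝐳 → 𝐳 ≤ᴸ / x / → components 𝐳 zero ≤ᴵ t → 𝐳 ≤ᴸ 𝐰
      ≤𝐰 𝐳 𝐳≤x z≤t = splice-elim 1 / t / / x / t≤x′ (λ i w → components 𝐳 i ≤ᴵ w)
        (λ { zero _ → z≤t ; (suc _) (s≤s ()) }) (λ i _ → 𝐳≤x i)

  -- Dually, with `t` the smaller last component and the lower bound `(x,…,x,t)`.
  degenerate-meet-irreducible : ∀ x (𝐮 𝐯 : Lₙ n) → / x / ≤ᴸ 𝐮 → / x / ≤ᴸ 𝐯 →
    (∀ 𝐰 → 𝐰 ≤ᴸ 𝐮 → 𝐰 ≤ᴸ 𝐯 → 𝐰 ≤ᴸ / x /) → ¬ ¬ (𝐮 ≤ᴸ / x / ⊎ 𝐯 ≤ᴸ / x /)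
  degenerate-meet-irreducible x 𝐮 𝐯 x≤𝐮 x≤𝐯 greatest k =
    ≤ᴵ-total (components 𝐮 last) (components 𝐯 last)
      λ { (inj₁ u≤v) → k (inj₁ (λ i → ≤x (components 𝐮 last) (x≤𝐮 last) id u≤v ∘ ≤last 𝐮 i))
        ; (inj₂ v≤u) → k (inj₂ (λ i → ≤x (components 𝐯 last) (x≤𝐯 last) v≤u id ∘ ≤last 𝐯 i))
        }
    where
    ≤x : ∀ t → x ≤ᴵ t → t ≤ᴵ components 𝐮 last → t ≤ᴵ components 𝐯 last → t ≤ᴵ x
    ≤x t x≤t t≤u t≤v =
      -- For a variable `m` the splice does not compute at `last`, so its entry there is rewritten
      -- to `t`.
      subst (_≤ᴵ x) (splice-≥ m / x / / t / x≤t′ last (ℕ.≤-reflexive (sym (Fin.toℕ-fromℕ m))))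
        (greatest 𝐰 (𝐰≤ 𝐮 x≤𝐮 t≤u) (𝐰≤ 𝐯 x≤𝐯 t≤v) last)
      where
      x≤t′ : (i j : Fin n) → toℕ i < m → m ≤ toℕ j → x ≤ᴵ t
      x≤t′ _ _ _ _ = x≤t

      𝐰 : Lₙ n
      𝐰 = splice m / x / / t / x≤t′

      𝐰≤ : ∀ 𝐳 → / x / ≤ᴸ 𝐳 → t ≤ᴵ components 𝐳 last → 𝐰 ≤ᴸ 𝐳
      𝐰≤ 𝐳 x≤𝐳 t≤z = splice-elim m / x / / t / x≤t′ (λ i w → w ≤ᴵ components 𝐳 i)
        (λ i _ → x≤𝐳 i)
        (λ i m≤i → increasing 𝐳 {last} {i} (ℕ.≤-trans (ℕ.≤-reflexive (Fin.toℕ-fromℕ m)) m≤i) ∘ t≤z)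

  -- Images of degenerate elements under a strong negation

  module _ {𝒩 : Lₙ n → Lₙ n} (strong : IsStrongFuzzyNegation 𝒩) where
    open IsStrongFuzzyNegation strong using (antitone; involutive; 𝒩/0/≈/1/; 𝒩/1/≈/0/)

    𝒩-swapʳ : ∀ 𝐚 𝐛 → 𝐚 ≤ᴸ 𝒩 𝐛 → 𝐛 ≤ᴸ 𝒩 𝐚
    𝒩-swapʳ 𝐚 𝐛 𝐚≤𝒩𝐛 i = antitone {𝐚} {𝒩 𝐛} 𝐚≤𝒩𝐛 i ∘ proj₂ (involutive 𝐛 i)

    𝒩-swapˡ : ∀ 𝐚 𝐛 → 𝒩 𝐚 ≤ᴸ 𝐛 → 𝒩 𝐛 ≤ᴸ 𝐚
    𝒩-swapˡ 𝐚 𝐛 𝒩𝐚≤𝐛 i = proj₁ (involutive 𝐚 i) ∘ antitone {𝒩 𝐚} {𝐛} 𝒩𝐚≤𝐛 i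

    -- `𝒩` is an order-reversing involution, so it turns this meet into a join with value `/ x /`.
    𝒩-meet-irreducible : ∀ x 𝐮 𝐯 → 𝒩 / x / ≤ᴸ 𝐮 → 𝒩 / x / ≤ᴸ 𝐯 →
      (∀ 𝐰 → 𝐰 ≤ᴸ 𝐮 → 𝐰 ≤ᴸ 𝐯 → 𝐰 ≤ᴸ 𝒩 / x /) → ¬ ¬ (𝐮 ≤ᴸ 𝒩 / x / ⊎ 𝐯 ≤ᴸ 𝒩 / x /)
    𝒩-meet-irreducible x 𝐮 𝐯 c≤𝐮 c≤𝐯 greatest k =
      degenerate-join-irreducible x (𝒩 𝐮) (𝒩 𝐯) (𝒩-swapˡ / x / 𝐮 c≤𝐮) (𝒩-swapˡ / x / 𝐯 c≤𝐯)
        (λ 𝐰 𝒩𝐮≤𝐰 𝒩𝐯≤𝐰 → λ i →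
          𝒩𝒩≤ 𝐰 i ∘ 𝒩-swapʳ (𝒩 𝐰) / x / (greatest (𝒩 𝐰) (𝒩-swapˡ 𝐮 𝐰 𝒩𝐮≤𝐰) (𝒩-swapˡ 𝐯 𝐰 𝒩𝐯≤𝐰)) i)
        (k ∘ map (𝒩-swapʳ / x / 𝐮) (𝒩-swapʳ / x / 𝐯))
      where
      𝒩𝒩≤ : ∀ 𝐰 → 𝒩 (𝒩 𝐰) ≤ᴸ 𝐰
      𝒩𝒩≤ 𝐰 i = proj₁ (involutive 𝐰 i)

    𝒩-join-irreducible : ∀ x 𝐮 𝐯 → 𝐮 ≤ᴸ 𝒩 / x / → 𝐯 ≤ᴸ 𝒩 / x / →
      (∀ 𝐰 → 𝐮 ≤ᴸ 𝐰 → 𝐯 ≤ᴸ 𝐰 → 𝒩 / x / ≤ᴸ 𝐰) → ¬ ¬ (𝒩 / x / ≤ᴸ 𝐮 ⊎ 𝒩 / x / ≤ᴸ 𝐯)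
    𝒩-join-irreducible x 𝐮 𝐯 𝐮≤c 𝐯≤c least k =
      degenerate-meet-irreducible x (𝒩 𝐮) (𝒩 𝐯) (𝒩-swapʳ 𝐮 / x / 𝐮≤c) (𝒩-swapʳ 𝐯 / x / 𝐯≤c)
        (λ 𝐰 𝐰≤𝒩𝐮 𝐰≤𝒩𝐯 → λ i →
          𝒩-swapˡ / x / (𝒩 𝐰) (least (𝒩 𝐰) (𝒩-swapʳ 𝐰 𝐮 𝐰≤𝒩𝐮) (𝒩-swapʳ 𝐰 𝐯 𝐰≤𝒩𝐯)) i ∘ ≤𝒩𝒩 𝐰 i)
        (k ∘ map (𝒩-swapˡ 𝐮 / x /) (𝒩-swapˡ 𝐯 / x /))
      where
      ≤𝒩𝒩 : ∀ 𝐰 → 𝐰 ≤ᴸ 𝒩 (𝒩 𝐰)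
      ≤𝒩𝒩 𝐰 i = proj₂ (involutive 𝐰 i)

    -- 𝐜 is the meet of (cⱼ,…,cⱼ,cⱼ₊₁,…,cₙ) and (c₁,…,cⱼ₋₁,1,…,1).
    component-first-or-1 : ∀ x (i : Fin m) → let c = components (𝒩 / x /) in
      ¬ ¬ (c (suc i) ≤ᴵ c zero ⊎ 1ᴵ ≤ᴵ c (suc i))
    component-first-or-1 x i k =
      𝒩-meet-irreducible x 𝐮 𝐯
        (splice-elim K / c j / 𝐜 mono-u (λ l z → c l ≤ᴵ z)
          (λ l l<j → increasing 𝐜 {l} {j} (ℕ.<⇒≤ l<j)) (λ _ _ → id))
        (splice-elim K 𝐜 / 1ᴵ / mono-v (λ l z → c l ≤ᴵ z) (λ _ _ → id) (λ l _ → value≤1 (c l)))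
        (λ 𝐰 𝐰≤𝐮 𝐰≤𝐯 l → below 𝐰 l (𝐰≤𝐮 l) (𝐰≤𝐯 l))
        -- Since `j` is a successor, index `zero` lies before the cut, where the entry of `𝐮` is
        -- `c j`.
        λ { (inj₁ 𝐮≤𝐜) → k (inj₁ (𝐮≤𝐜 zero))
          ; (inj₂ 𝐯≤𝐜) → k (inj₂ (subst (_≤ᴵ c j) (splice-≥ K 𝐜 / 1ᴵ / mono-v j ℕ.≤-refl) (𝐯≤𝐜 j)))
          }
      where
      𝐜 = 𝒩 / x /
      c = components 𝐜
      j : Fin n
      j = suc i
      K = toℕ j

      mono-u : (l l′ : Fin n) → toℕ l < K → K ≤ toℕ l′ → c j ≤ᴵ c l′
      mono-u _ l′ _ j≤l′ = increasing 𝐜 {j} {l′} j≤l′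

      mono-v : (l l′ : Fin n) → toℕ l < K → K ≤ toℕ l′ → c l ≤ᴵ 1ᴵ
      mono-v l _ _ _ = value≤1 (c l)

      𝐮 𝐯 : Lₙ n
      𝐮 = splice K / c j / 𝐜 mono-u
      𝐯 = splice K 𝐜 / 1ᴵ / mono-v

      below : ∀ 𝐰 l → components 𝐰 l ≤ᴵ components 𝐮 l → components 𝐰 l ≤ᴵ components 𝐯 l →
              components 𝐰 l ≤ᴵ c l
      -- On either side of the cut, one of the two splices has entry `c l`.
      below 𝐰 l with ℕ.<-≤-connex (toℕ l) K
      ... | inj₁ _ = λ _ w≤v → w≤v
      ... | inj₂ _ = λ w≤u _ → w≤u

    last≤first-or-first≤0 : ∀ x → let c = components (𝒩 / x /) in
      ¬ ¬ (c last ≤ᴵ c zero ⊎ c zero ≤ᴵ 0ᴵ)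
    last≤first-or-first≤0 x k =
      𝒩-join-irreducible x / c zero / 𝐯 (first≤ 𝐜)
        (splice-elim 1 / 0ᴵ / 𝐜 mono (λ l z → z ≤ᴵ c l) (λ l _ → 0≤value (c l)) (λ _ _ → id))
        (λ { 𝐰 𝐮≤𝐰 𝐯≤𝐰 zero → 𝐮≤𝐰 zero ; 𝐰 𝐮≤𝐰 𝐯≤𝐰 (suc l) → 𝐯≤𝐰 (suc l) })
        λ { (inj₁ 𝐜≤𝐮) → k (inj₁ (𝐜≤𝐮 last)) ; (inj₂ 𝐜≤𝐯) → k (inj₂ (𝐜≤𝐯 zero)) }
      where
      𝐜 = 𝒩 / x /
      c = components 𝐜

      mono : (l l′ : Fin n) → toℕ l < 1 → 1 ≤ toℕ l′ → 0ᴵ ≤ᴵ c l′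
      mono _ l′ _ _ = 0≤value (c l′)

      𝐯 : Lₙ n
      𝐯 = splice 1 / 0ᴵ / 𝐜 mono

    -- Downward induction on `i`; `x` stays quantified because the step passes to a larger point `y`
    -- below 1.
    component≰0 : ∀ i x → ¬ (1ᴵ ≤ᴵ x) → ¬ (components (𝒩 / x /) i ≤ᴵ 0ᴵ)
    component≰0 = Fin.>-weakInduction
      (λ i → ∀ x → ¬ (1ᴵ ≤ᴵ x) → ¬ (components (𝒩 / x /) i ≤ᴵ 0ᴵ)) base step
      where
      base : ∀ x → ¬ (1ᴵ ≤ᴵ x) → ¬ (components (𝒩 / x /) last ≤ᴵ 0ᴵ)
      -- A zero last component puts `𝒩 / x /` below `/ 0ᴵ /`, hence `𝒩 / 0ᴵ /`, which is `/ 1ᴵ /`,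
      -- below `/ x /`.
      base x 1≰x c≤0 = 1≰x
        (𝒩-swapˡ / x / / 0ᴵ / (λ i → c≤0 ∘ ≤last (𝒩 / x /) i) zero ∘ proj₂ (𝒩/0/≈/1/ zero))

      step : ∀ i → (∀ x → ¬ (1ᴵ ≤ᴵ x) → ¬ (components (𝒩 / x /) (suc i) ≤ᴵ 0ᴵ)) →
             ∀ x → ¬ (1ᴵ ≤ᴵ x) → ¬ (components (𝒩 / x /) (inject₁ i) ≤ᴵ 0ᴵ)
      step i ih x 1≰x cᵢ≤0 = between-1 x 1≰x λ (y , x≤y , y≰x , 1≰y) →
        let 𝐜 = 𝒩 / x / ; c = components 𝐜
            𝐝 = 𝒩 / y / ; d = components 𝐝

            𝐝≤𝐜 : 𝐝 ≤ᴸ 𝐜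
            𝐝≤𝐜 = antitone {/ x /} {/ y /} (λ _ → x≤y)

            -- Up to `i` the tuple `𝐜` is zero, and beyond `i` the tuple `𝐝` is one. Applying `𝒩` to
            -- the resulting inequality would give `y ≤ᴵ x`.
            𝐜≤𝐝 : 1ᴵ ≤ᴵ d (suc i) → 𝐜 ≤ᴸ 𝐝
            𝐜≤𝐝 1≤d l = [ (λ l≤i → 0≤value (d l) ∘ cᵢ≤0 ∘ increasing 𝐜 {l} {inject₁ i}
                                    (ℕ.≤-trans l≤i (ℕ.≤-reflexive (sym (Fin.toℕ-inject₁ i)))))
                        , (λ i<l → increasing 𝐝 {suc i} {l} i<l ∘ 1≤d ∘ value≤1 (c l))
                        ] (ℕ.≤-<-connex (toℕ l) (toℕ i))
        in component-first-or-1 y i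
          -- Here `d (suc i)` is at most `d zero`, hence at most the vanishing component of `𝐜`,
          -- against the hypothesis at `y`.
          λ { (inj₁ d≤d₀) → ih y 1≰y (cᵢ≤0 ∘ 𝐝≤𝐜 (inject₁ i) ∘ first≤ 𝐝 (inject₁ i) ∘ d≤d₀)
            ; (inj₂ 1≤d)  → y≰x (proj₁ (involutive / x / zero) ∘
                                 𝒩-swapʳ 𝐜 / y / (𝐜≤𝐝 1≤d) zero)
            }

    𝒩-last≤first : ∀ x → components (𝒩 / x /) last ≤ᴵ components (𝒩 / x /) zero
    𝒩-last≤first x = ≤ℝ-stable (value (c last)) (value (c zero)) λ cₙ≰c₁ →
      last≤first-or-first≤0 x
        λ { (inj₁ cₙ≤c₁) → cₙ≰c₁ cₙ≤c₁
          ; (inj₂ c₁≤0)  → component≰0 zero x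
              -- If `x` is 1, then `𝒩 / x /` lies below `/ 0ᴵ /`, so its last component is at most
              -- its first.
              (λ 1≤x → cₙ≰c₁ (0≤value (c zero) ∘ proj₁ (𝒩/1/≈/0/ last)
                               ∘ antitone {/ 1ᴵ /} {/ x /} (λ _ → 1≤x) last))
              c₁≤0
          }
      where
      c = components (𝒩 / x /)

corollary22 : ∀ (n : ℕ) → 1 ≤ n → (𝒩 : Lₙ n → Lₙ n) → IsStrongFuzzyNegation 𝒩 →
    ∀ (x : [0,1]) → 𝒩 / x / ∈ 𝒟 n
corollary22 (suc m) _ 𝒩 strong x =
  -- Every component lies between the first and the last, and the last is at most the first.
  components (𝒩 / x /) zero ,
  λ i → (𝒩-last≤first strong x ∘ ≤last (𝒩 / x /) i) , first≤ (𝒩 / x /) i
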